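{- For every integer $n\ge 3$ with $n\ne 6$, $$R(B_{n-2},B_n)\le 4n-3.$$
   Context: For a positive integer $n$, the book graph $B_n=K_2+\overline{K}_n$ is the graph consisting of $n$ triangles sharing a common edge. The Ramsey number $R(B_m,B_n)$ is the smallest integer $N$ such that every red/blue coloring of the edges of $K_N$ contains a red copy of $B_m$ or a blue copy of $B_n$ (copies are as not necessarily induced subgraphs). -}

module Defs where

open import Data.Fin using (Fin)
open import Data.Nat using (ℕ; _≤_)
open import Data.Product using (_×_; _,_; Σ-syntax)
open import Data.Sum using (_⊎_; inj₁; inj₂)
open import Data.Unit using (⊤; tt)
open import Function.Definitions using (Injective)
open import Level using (0ℓ)
open import Relation.Binary.Core using (Rel)
open import Relation.Binary.Definitions using (Symmetric; Irreflexive)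
open import Relation.Binary.PropositionalEquality
  using (_≡_; _≢_; refl; sym; trans; ≢-sym)
open import Relation.Nullary using (¬_)

record Graph : Set₁ where
  field
    Vertex : Set
    Adj    : Rel Vertex 0ℓ
    symm   : Symmetric Adj
    irrefl : Irreflexive _≡_ Adj

open Graph

complete : ℕ → Graph
complete n = record
  { Vertex = Fin n
  ; Adj    = _≢_
  ; symm   = ≢-sym
  ; irrefl = λ u≡v u≢v → u≢v u≡v
  }

complement : Graph → Graph
complement G = record
  { Vertex = Vertex G
  ; Adj    = λ u v → u ≢ v × ¬ Adj G u v
  ; symm   = λ (u≢v , ¬uv) → ≢-sym u≢v , λ vu → ¬uv (symm G vu)
  ; irrefl = λ u≡v (u≢v , _) → u≢v u≡v
  }

join : Graph → Graph → Graph
join G H = record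
  { Vertex = Vertex G ⊎ Vertex H
  ; Adj    = adj
  ; symm   = λ {x} {y} → adj-sym x y
  ; irrefl = λ {x} {y} → adj-irrefl x y
  }
  where
  adj : Rel (Vertex G ⊎ Vertex H) 0ℓ
  adj (inj₁ u) (inj₁ v) = Adj G u v
  adj (inj₁ _) (inj₂ _) = ⊤
  adj (inj₂ _) (inj₁ _) = ⊤
  adj (inj₂ u) (inj₂ v) = Adj H u v

  adj-sym : ∀ x y → adj x y → adj y x
  adj-sym (inj₁ _) (inj₁ _) uv = symm G uv
  adj-sym (inj₁ _) (inj₂ _) _  = tt
  adj-sym (inj₂ _) (inj₁ _) _  = tt
  adj-sym (inj₂ _) (inj₂ _) uv = symm H uv

  adj-irrefl : ∀ x y → x ≡ y → ¬ adj x y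
  adj-irrefl (inj₁ _) (inj₁ _) refl uu = irrefl G refl uu
  adj-irrefl (inj₂ _) (inj₂ _) refl uu = irrefl H refl uu

book : ℕ → Graph
book n = join (complete 2) (complement (complete n))

Contains : Graph → Graph → Set
Contains H G =
  Σ[ f ∈ (Vertex G → Vertex H) ]
    (Injective _≡_ _≡_ f × (∀ {u v} → Adj G u v → Adj H (f u) (f v)))

data Color : Set where
  red blue : Color

-- The edge {i , j} has colour  color i j ; the diagonal values carry no
-- information, since colorGraph below only looks at distinct i and j.
record EdgeColoring (N : ℕ) : Set where
  field
    color      : Fin N → Fin N → Color
    color-symm : ∀ i j → color i j ≡ color j i

open EdgeColoring

colorGraph : ∀ {N} → EdgeColoring N → Color → Graph
colorGraph {N} χ c = record
  { Vertex = Fin N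
  ; Adj    = λ i j → i ≢ j × color χ i j ≡ c
  ; symm   = λ {i} {j} (i≢j , ij) → ≢-sym i≢j , trans (color-symm χ j i) ij
  ; irrefl = λ i≡j (i≢j , _) → i≢j i≡j
  }

Arrows : ℕ → Graph → Graph → Set
Arrows N G H = (χ : EdgeColoring N) →
  Contains (colorGraph χ red) G ⊎ Contains (colorGraph χ blue) H

-- As a relation: r is the least N with N → (G , H).
IsRamseyNumber : Graph → Graph → ℕ → Set
IsRamseyNumber G H r = Arrows r G H × (∀ N → Arrows N G H → r ≤ N)

{-# OPTIONS --safe #-}

-- Let N = 4n - 3 and let S be the ±1 matrix (zero diagonal, +1 for red) of a
-- colouring of K_N with neither book.  Four times the number of pages missing on
-- the edge uv is -1 - 4 s_uv - (S²)_uv - s_uv (t_u + t_v) ≥ 0, where t_u is the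
-- row sum; summed over all u ≠ v this is - Σ (4 t_u + 3 t_u²).  As N is odd,
-- t_u is even, so 4 t_u + 3 t_u² ≥ 0 as well, and all these
-- nonnegative quantities vanish.
-- Hence X = 2S + J + 4I satisfies X² = d (J + 4I) with d = N + 4 = 4n + 1.
--
-- An integer matrix with d ∣ X² has d ∣ (tr X)²: peeling off the Smith normal
-- form writes tr X as a sum of integers xᵢ with d ∣ xᵢ², and such integers are closed
-- under addition.  Since tr X = 5N, this gives d ∣ 25 N², so d ∣ 400,
-- and the odd d is 1, 5 or 25, that is n = 0, 1 or 6.
module Submission where

open import Data.Bool using (Bool; true; false; not; _∧_; _∨_; if_then_else_)
open import Data.Bool.Properties using (∨-comm; ∨-idem)
open import Data.Empty using (⊥-elim)
open import Data.Fin using (Fin; zero; suc; combine; remQuot; toℕ; fromℕ<; punchIn)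
open import Data.Fin.Properties
  using (_≟_; all?; any?; ¬∀⟶∃¬; punchInᵢ≢i; injective⇒≤; suc-injective; remQuot-combine; toℕ-fromℕ<)
open import Data.Fin.Subset using (Subset)
open import Data.Fin.Subset.Properties using (anySubset?)
open import Data.Nat using (ℕ; zero; suc; z≤n; s≤s)
import Data.Nat as ℕ
import Data.Nat.Coprimality as ℕ
import Data.Nat.DivMod as ℕ
import Data.Nat.Divisibility as ℕ
import Data.Nat.GCD as ℕ
open import Data.Nat.Induction using (<-wellFounded; Acc; acc)
import Data.Nat.Properties as ℕ
open import Data.Product using (∃-syntax; Σ-syntax; _×_; _,_; proj₁; proj₂)
open import Data.Sum using (_⊎_; inj₁; inj₂)
open import Data.Unit using (tt)
open import Data.Vec using (lookup; tabulate)
open import Data.Vec.Functional using (Vector)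
open import Data.Vec.Properties using (lookup∘tabulate)
open import Function using (_∘_; case_of_)
open import Function.Definitions using (Injective)
open import Relation.Binary.PropositionalEquality
open import Relation.Nullary using (Dec; yes; no; does; ¬_)
open import Relation.Nullary.Decidable
  using (_×-dec_; _⊎-dec_; _→-dec_; ¬?; map′; decidable-stable; from-yes; from-no)
open import Relation.Unary using (Decidable)
open import Defs
open EdgeColoring

-- Books, and decidability of the arrow relation

count : ∀ {n} {P : Fin n → Set} → Decidable P → ℕ
count {zero}  P? = 0
count {suc n} P? = if does (P? zero) then suc (count (P? ∘ suc)) else count (P? ∘ suc)

choose : ∀ {n m} {P : Fin n → Set} (P? : Decidable P) → m ℕ.≤ count P? →
  Σ[ g ∈ (Fin m → Fin n) ] (Injective _≡_ _≡_ g × (∀ i → P (g i)))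
choose {m = zero} P? _ = (λ ()) , (λ { {()} }) , (λ ())
choose {suc n} {suc m} P? m<count with P? zero
choose {suc n} {suc m} P? (s≤s m≤count) | yes p with choose (P? ∘ suc) m≤count
... | g , g-inj , Pg = g′ , g′-inj , Pg′
  where
  g′ : Fin (suc m) → Fin (suc n)
  g′ zero    = zero
  g′ (suc i) = suc (g i)
  g′-inj : Injective _≡_ _≡_ g′
  g′-inj {zero}  {zero}  _  = refl
  g′-inj {suc i} {suc j} eq = cong suc (g-inj (suc-injective eq))
  Pg′ : ∀ i → _
  Pg′ zero    = p
  Pg′ (suc i) = Pg i
choose {suc n} {suc m} P? m<count | no _ with choose (P? ∘ suc) m<count
... | g , g-inj , Pg = suc ∘ g , g-inj ∘ suc-injective , Pg

-- The position of `i` among the indices satisfying `P`. Composing with it turns an injection into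
-- those indices into one into `Fin (count P?)`, where the pigeonhole principle applies.
rank : ∀ {n} {P : Fin n → Set} (P? : Decidable P) i → P i → Fin (count P?)
rank P? zero p with P? zero
... | yes _ = zero
... | no ¬p = ⊥-elim (¬p p)
rank P? (suc i) p with P? zero
... | yes _ = suc (rank (P? ∘ suc) i p)
... | no _  = rank (P? ∘ suc) i p

rank-injective : ∀ {n} {P : Fin n → Set} (P? : Decidable P) {i j} (p : P i) (q : P j) →
  rank P? i p ≡ rank P? j q → i ≡ j
rank-injective P? {zero}  {zero}  p q eq = refl
rank-injective P? {zero}  {suc j} p q eq with P? zero
... | no ¬p = ⊥-elim (¬p p)
rank-injective P? {suc i} {zero}  p q eq with P? zero
... | no ¬p = ⊥-elim (¬p q)
rank-injective P? {suc i} {suc j} p q eq with P? zero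
... | yes _ = cong suc (rank-injective (P? ∘ suc) p q (suc-injective eq))
... | no _  = cong suc (rank-injective (P? ∘ suc) p q eq)

injection⇒≤count : ∀ {n m} {P : Fin n → Set} (P? : Decidable P) {g : Fin m → Fin n} →
  Injective _≡_ _≡_ g → (∀ i → P (g i)) → m ℕ.≤ count P?
injection⇒≤count P? {g} g-inj Pg =
  injective⇒≤ {f = λ i → rank P? (g i) (Pg i)} (g-inj ∘ rank-injective P? _ _)

_≟ᶜ_ : (c c′ : Color) → Dec (c ≡ c′)
red  ≟ᶜ red  = yes refl
red  ≟ᶜ blue = no λ ()
blue ≟ᶜ red  = no λ ()
blue ≟ᶜ blue = yes refl

module _ {N} (χ : EdgeColoring N) where

  Edge : Color → Fin N → Fin N → Set
  Edge c = Graph.Adj (colorGraph χ c)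

  edge? : ∀ c u v → Dec (Edge c u v)
  edge? c u v = ¬? (u ≟ v) ×-dec (color χ u v ≟ᶜ c)

  page? : ∀ c u v → Decidable (λ w → Edge c u w × Edge c v w)
  page? c u v w = edge? c u w ×-dec edge? c v w

  pages : Color → Fin N → Fin N → ℕ
  pages c u v = count (page? c u v)

  HasSpine : Color → ℕ → Set
  HasSpine c m = ∃[ u ] ∃[ v ] (Edge c u v × m ℕ.≤ pages c u v)

  hasSpine? : ∀ c m → Dec (HasSpine c m)
  hasSpine? c m = any? λ u → any? λ v → edge? c u v ×-dec (m ℕ.≤? pages c u v)

  spine⇒book : ∀ {c m} → HasSpine c m → Contains (colorGraph χ c) (book m)
  spine⇒book {c} {m} (u , v , uv , m≤pages) with choose (page? c u v) m≤pages
  ... | g , g-inj , g-page = f , f-inj , λ {x} {y} → f-adj x y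
    where
    f : Fin 2 ⊎ Fin m → Fin N
    f (inj₁ zero)       = u
    f (inj₁ (suc zero)) = v
    f (inj₂ i)          = g i

    swap : ∀ {x y} → Edge c x y → Edge c y x
    swap = Graph.symm (colorGraph χ c)

    f-adj : ∀ x y → Graph.Adj (book m) x y → Edge c (f x) (f y)
    f-adj (inj₁ zero)       (inj₁ zero)       x≢x = ⊥-elim (x≢x refl)
    f-adj (inj₁ zero)       (inj₁ (suc zero)) _   = uv
    f-adj (inj₁ (suc zero)) (inj₁ zero)       _   = swap uv
    f-adj (inj₁ (suc zero)) (inj₁ (suc zero)) x≢x = ⊥-elim (x≢x refl)
    f-adj (inj₁ zero)       (inj₂ i)          _   = proj₁ (g-page i)
    f-adj (inj₁ (suc zero)) (inj₂ i)          _   = proj₂ (g-page i)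
    f-adj (inj₂ i)          (inj₁ zero)       _   = swap (proj₁ (g-page i))
    f-adj (inj₂ i)          (inj₁ (suc zero)) _   = swap (proj₂ (g-page i))
    f-adj (inj₂ i)          (inj₂ j) (i≢j , ¬i≢j) = ⊥-elim (¬i≢j i≢j)

    f-inj : Injective _≡_ _≡_ f
    f-inj {inj₂ i} {inj₂ j} eq = cong inj₂ (g-inj eq)
    f-inj {inj₁ zero}       {inj₁ zero}       eq = refl
    f-inj {inj₁ (suc zero)} {inj₁ (suc zero)} eq = refl
    f-inj {inj₁ zero}       {inj₁ (suc zero)} eq = ⊥-elim (proj₁ uv eq)
    f-inj {inj₁ (suc zero)} {inj₁ zero}       eq = ⊥-elim (proj₁ uv (sym eq))
    f-inj {inj₁ zero}       {inj₂ i}          eq = ⊥-elim (proj₁ (proj₁ (g-page i)) eq)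
    f-inj {inj₁ (suc zero)} {inj₂ i}          eq = ⊥-elim (proj₁ (proj₂ (g-page i)) eq)
    f-inj {inj₂ i}          {inj₁ zero}       eq = ⊥-elim (proj₁ (proj₁ (g-page i)) (sym eq))
    f-inj {inj₂ i}          {inj₁ (suc zero)} eq = ⊥-elim (proj₁ (proj₂ (g-page i)) (sym eq))

  -- With `spine⇒book` this makes containment of a book equivalent to a condition on edges and page
  -- counts, which is decidable because `Fin N` is finite.
  book⇒spine : ∀ {c m} → Contains (colorGraph χ c) (book m) → HasSpine c m
  book⇒spine {c} {m} (f , f-inj , f-adj) =
    f (inj₁ zero) , f (inj₁ (suc zero)) , f-adj {inj₁ zero} {inj₁ (suc zero)} (λ ()) ,
    injection⇒≤count (page? c _ _) {g = f ∘ inj₂} (λ eq → inj₂-inj (f-inj eq))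
      (λ i → f-adj {inj₁ zero} {inj₂ i} tt , f-adj {inj₁ (suc zero)} {inj₂ i} tt)
    where
    inj₂-inj : ∀ {i j : Fin m} → inj₂ {A = Fin 2} i ≡ inj₂ j → i ≡ j
    inj₂-inj refl = refl

  ContainsBook : ℕ → ℕ → Set
  ContainsBook a b =
    Contains (colorGraph χ red) (book a) ⊎ Contains (colorGraph χ blue) (book b)

  containsBook? : ∀ a b → Dec (ContainsBook a b)
  containsBook? a b =
    map′ spine⇒book book⇒spine (hasSpine? red a) ⊎-dec map′ spine⇒book book⇒spine (hasSpine? blue b)

-- Exhaustive search over colourings

recolour : ∀ {N} (χ χ′ : EdgeColoring N) → (∀ i j → color χ i j ≡ color χ′ i j) →
  ∀ {a b} → ContainsBook χ a b → ContainsBook χ′ a b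
recolour χ χ′ eq (inj₁ (f , f-inj , f-adj)) =
  inj₁ (f , f-inj , λ {u} {v} uv → proj₁ (f-adj {u} {v} uv) , trans (sym (eq _ _))
       (proj₂ (f-adj {u} {v} uv)))
recolour χ χ′ eq (inj₂ (f , f-inj , f-adj)) =
  inj₂ (f , f-inj , λ {u} {v} uv → proj₁ (f-adj {u} {v} uv) , trans (sym (eq _ _))
       (proj₂ (f-adj {u} {v} uv)))

isRed : Color → Bool
isRed red  = true
isRed blue = false

fromBool : Bool → Color
fromBool true  = red
fromBool false = blue

fromBool∘isRed : ∀ c → fromBool (isRed c) ≡ c
fromBool∘isRed red  = refl
fromBool∘isRed blue = refl

-- Every set of ordered pairs must yield a colouring, so the set is symmetrised by `∨`: a pair is
-- red if either of its orientations belongs to the set.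
decode : ∀ {N} → Subset (N ℕ.* N) → EdgeColoring N
decode p = record
  { color      = λ i j → fromBool (lookup p (combine i j) ∨ lookup p (combine j i))
  ; color-symm = λ i j → cong fromBool (∨-comm (lookup p (combine i j)) (lookup p (combine j i)))
  }

encode : ∀ {N} → EdgeColoring N → Subset (N ℕ.* N)
encode {N} χ = tabulate λ x → isRed (color χ (proj₁ (remQuot {N} N x)) (proj₂ (remQuot {N} N x)))

-- The symmetrisation is harmless here since `color χ` is already symmetric. The agreement is
-- pointwise, which is why `recolour` is needed to transport books.
decode∘encode : ∀ {N} (χ : EdgeColoring N) i j → color (decode (encode χ)) i j ≡ color χ i j
decode∘encode {N} χ i j = begin
  fromBool (lookup (encode χ) (combine i j) ∨ lookup (encode χ) (combine j i))
    ≡⟨ cong₂ (λ x y → fromBool (x ∨ y)) (entry i j) (entry j i) ⟩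
  fromBool (isRed (color χ i j) ∨ isRed (color χ j i))
    ≡⟨ cong (λ c → fromBool (isRed (color χ i j) ∨ isRed c)) (color-symm χ j i) ⟩
  fromBool (isRed (color χ i j) ∨ isRed (color χ i j))
    ≡⟨ cong fromBool (∨-idem (isRed (color χ i j))) ⟩
  fromBool (isRed (color χ i j))
    ≡⟨ fromBool∘isRed (color χ i j) ⟩
  color χ i j ∎
  where
  open ≡-Reasoning
  entry : ∀ i j → lookup (encode χ) (combine i j) ≡ isRed (color χ i j)
  entry i j = trans (lookup∘tabulate _ (combine i j))
    (cong (λ ij → isRed (color χ (proj₁ ij) (proj₂ ij))) (remQuot-combine {N} i j))

-- The colourings decoded from the finitely many subsets represent all colourings up to pointwise
-- equality, so a search among them for one avoiding both books decides the relation. It is what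
-- allows the least `N` to be computed.
arrows? : ∀ a b N → Dec (Arrows N (book a) (book b))
arrows? a b N with anySubset? {n = N ℕ.* N} (λ p → ¬? (containsBook? (decode p) a b))
... | yes (p , ¬contains) = no λ arrows → ¬contains (arrows (decode p))
... | no ∄avoiding = yes λ χ → decidable-stable (containsBook? χ a b) λ ¬contains →
  ∄avoiding (encode χ , ¬contains ∘ recolour (decode (encode χ)) χ (decode∘encode χ))

least : ∀ {P : ℕ → Set} → (∀ n → Dec (P n)) → ∀ n → P n →
  ∃[ r ] ((P r × (∀ m → P m → r ℕ.≤ m)) × r ℕ.≤ n)
least P? n p with P? 0
... | yes p₀ = 0 , (p₀ , λ _ _ → z≤n) , z≤n
least P? zero p | no ¬p₀ = ⊥-elim (¬p₀ p)
least {P} P? (suc n) p | no ¬p₀ with least (P? ∘ suc) n p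
... | r , (pᵣ , minimal) , r≤n = suc r , (pᵣ , minimal′) , s≤s r≤n
  where
  minimal′ : ∀ m → P m → suc r ℕ.≤ m
  minimal′ zero    p₀ = ⊥-elim (¬p₀ p₀)
  minimal′ (suc m) pₘ = s≤s (minimal m pₘ)

-- Traces of integer matrices

module IntegerMatrix where

  open import Data.Integer
    using (ℤ; +_; 0ℤ; 1ℤ; ∣_∣; _+_; _*_; _-_; -_; _%_; _/_; _≤_; NonZero; ≢-nonZero)
    renaming (_≟_ to _≟ᶻ_)
  open import Data.Integer.DivMod using (a≡a%n+[a/n]*n; n%d<d)
  open import Data.Integer.Divisibility.Signed
  open import Data.Integer.Properties
    using (+-*-semiring; abs-*; *-zeroʳ; *-comm; *-identityˡ; +-identityʳ; +-identityˡ; ≤-refl; +-mono-≤)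
  open import Data.Integer.Tactic.RingSolver using (solve-∀)
  open import Algebra.Properties.Semiring.Sum +-*-semiring public
    using (sum; sum-syntax; sum-cong-≗; sum-remove; ∑-distrib-+; ∑-comm;
           *-distribˡ-sum; *-distribʳ-sum; sum-replicate-zero)

  -- Dividing by the gcd leaves coprime `m′` and `n′` with `m′ * m′` dividing `n′ * n′`. By
  -- coprimality `m′` then divides `n′`, so it is 1 and the gcd is `m`.
  m²∣n²⇒m∣n : ∀ m n .{{_ : ℕ.NonZero m}} → m ℕ.* m ℕ.∣ n ℕ.* n → m ℕ.∣ n
  m²∣n²⇒m∣n m n m²∣n² = subst (ℕ._∣ n) g≡m g∣n
    where
    g = ℕ.gcd m n
    g∣m : g ℕ.∣ m
    g∣m = ℕ.gcd[m,n]∣m m n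
    g∣n : g ℕ.∣ n
    g∣n = ℕ.gcd[m,n]∣n m n
    instance
      g≢0 : ℕ.NonZero g
      g≢0 = ℕ.≢-nonZero (ℕ.gcd[m,n]≢0 m n (inj₁ (ℕ.≢-nonZero⁻¹ m)))
      g²≢0 : ℕ.NonZero (g ℕ.* g)
      g²≢0 = ℕ.m*n≢0 g g
    m′ = m ℕ./ g
    n′ = n ℕ./ g
    square : ∀ k → g ℕ.∣ k → k ℕ.* k ≡ (g ℕ.* g) ℕ.* (k ℕ./ g ℕ.* (k ℕ./ g))
    square k g∣k = trans (cong₂ ℕ._*_ eq eq) (ℕ.[m*n]*[o*p]≡[m*o]*[n*p] g (k ℕ./ g) g (k ℕ./ g))
      where eq = sym (ℕ.m*[n/m]≡n g∣k)
    m′²∣n′² : m′ ℕ.* m′ ℕ.∣ n′ ℕ.* n′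
    m′²∣n′² = ℕ.*-cancelˡ-∣ (g ℕ.* g) (subst₂ ℕ._∣_ (square m g∣m) (square n g∣n) m²∣n²)
    coprime : ℕ.Coprime m′ n′
    coprime = ℕ.coprime-/gcd m n
    m′≡1 : m′ ≡ 1
    m′≡1 = coprime (ℕ.∣-refl , ℕ.coprime-divisor coprime (ℕ.∣-trans (ℕ.m∣m*n m′) m′²∣n′²))
    g≡m : g ≡ m
    g≡m = trans (sym (ℕ.*-identityʳ g)) (trans (cong (g ℕ.*_) (sym m′≡1)) (ℕ.m*[n/m]≡n g∣m))

  i²∣j²⇒i∣j : ∀ i j .{{_ : NonZero i}} → i * i ∣ j * j → i ∣ j
  i²∣j²⇒i∣j i j h =
    ∣ᵤ⇒∣ (m²∣n²⇒m∣n ∣ i ∣ ∣ j ∣ (subst₂ ℕ._∣_ (abs-* i i) (abs-* j j) (∣⇒∣ᵤ h)))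

  ∣-* : ∀ {i j k l} → i ∣ k → j ∣ l → i * j ∣ k * l
  ∣-* {i} {j} (divides p refl) (divides q refl) = divides (p * q) (regroup p i q j)
    where
    regroup : ∀ p i q j → (p * i) * (q * j) ≡ (p * q) * (i * j)
    regroup = solve-∀

  -- Only the cross term needs an argument: (xy)² = x²y² is divisible by d², hence d divides xy.
  ∣-square-+ : ∀ d x y .{{_ : NonZero d}} → d ∣ x * x → d ∣ y * y → d ∣ (x + y) * (x + y)
  ∣-square-+ d x y d∣x² d∣y² = subst (d ∣_) (expand x y)
    (∣m∣n⇒∣m+n d∣x² (∣m∣n⇒∣m+n d∣y² (∣n⇒∣m*n (+ 2) d∣xy)))
    where
    expand : ∀ x y → x * x + (y * y + + 2 * (x * y)) ≡ (x + y) * (x + y)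
    expand = solve-∀
    regroup : ∀ x y → (x * y) * (x * y) ≡ (x * x) * (y * y)
    regroup = solve-∀
    d∣xy : d ∣ x * y
    d∣xy = i²∣j²⇒i∣j d (x * y)
      (subst (d * d ∣_) (sym (regroup x y)) (∣-* d∣x² d∣y²))

  -- Finite sums of integers

  ∣-sum : ∀ {d n} (f : Vector ℤ n) → (∀ i → d ∣ f i) → d ∣ sum f
  ∣-sum {n = zero}  f d∣f = divides 0ℤ refl
  ∣-sum {n = suc n} f d∣f = ∣m∣n⇒∣m+n (d∣f zero) (∣-sum (f ∘ suc) (d∣f ∘ suc))

  ∑-zero : ∀ {n} (f : Vector ℤ n) → (∀ i → f i ≡ 0ℤ) → sum f ≡ 0ℤ
  ∑-zero {n} f f≡0 = trans (sum-cong-≗ f≡0) (sum-replicate-zero n)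

  ∑-single : ∀ {n} (f : Vector ℤ n) i → (∀ k → k ≢ i → f k ≡ 0ℤ) → sum f ≡ f i
  ∑-single {suc n} f i f≡0 = trans (sum-remove f)
    (trans (cong (λ z → f i + z) (∑-zero _ λ k → f≡0 _ (punchInᵢ≢i i k))) (+-identityʳ (f i)))

  ∑-linear : ∀ {n} c (f g : Vector ℤ n) →
    ∑[ i < n ] (f i - c * g i) ≡ sum f - c * sum g
  ∑-linear {n} c f g = begin
    ∑[ i < n ] (f i - c * g i)          ≡⟨ sum-cong-≗ (λ i → sub (f i) c (g i)) ⟩
    ∑[ i < n ] (f i + (- c) * g i)      ≡⟨ ∑-distrib-+ f (λ i → (- c) * g i) ⟩
    sum f + ∑[ i < n ] ((- c) * g i)    ≡⟨ cong (λ z → sum f + z) (*-distribˡ-sum (- c) g) ⟨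
    sum f + (- c) * sum g               ≡⟨ sub (sum f) c (sum g) ⟨
    sum f - c * sum g                   ∎
    where
    open ≡-Reasoning
    sub : ∀ x c y → x - c * y ≡ x + (- c) * y
    sub = solve-∀

  ∑-const : ∀ n c → ∑[ i < n ] c ≡ + n * c
  ∑-const zero    c = refl
  ∑-const (suc n) c = trans (cong (λ z → c + z) (∑-const n c)) (step c (+ n))
    where
    step : ∀ c n → c + n * c ≡ (1ℤ + n) * c
    step = solve-∀

  ∑-nonNeg : ∀ {n} (f : Vector ℤ n) → (∀ i → 0ℤ ≤ f i) → 0ℤ ≤ sum f
  ∑-nonNeg {zero}  f 0≤f = ≤-refl
  ∑-nonNeg {suc n} f 0≤f = +-mono-≤ (0≤f zero) (∑-nonNeg (f ∘ suc) (0≤f ∘ suc))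

  nonNeg-+≡0 : ∀ {x y} → 0ℤ ≤ x → 0ℤ ≤ y → x + y ≡ 0ℤ → x ≡ 0ℤ × y ≡ 0ℤ
  nonNeg-+≡0 {+ zero}  {+ y} _ _ eq = refl , trans (sym (+-identityˡ _)) eq
  nonNeg-+≡0 {+ suc x} {+ y} _ _ ()

  ∑-nonNeg≡0 : ∀ {n} (f : Vector ℤ n) → (∀ i → 0ℤ ≤ f i) → sum f ≡ 0ℤ → ∀ i → f i ≡ 0ℤ
  ∑-nonNeg≡0 {suc n} f 0≤f ∑≡0 i with nonNeg-+≡0 (0≤f zero) (∑-nonNeg (f ∘ suc) (0≤f ∘ suc)) ∑≡0
  ∑-nonNeg≡0 {suc n} f 0≤f ∑≡0 zero    | f₀≡0 , _ = f₀≡0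
  ∑-nonNeg≡0 {suc n} f 0≤f ∑≡0 (suc i) | _ , rest = ∑-nonNeg≡0 (f ∘ suc) (0≤f ∘ suc) rest i

  -- Kronecker delta and matrix products

  ⟦_⟧ : Bool → ℤ
  ⟦ b ⟧ = if b then 1ℤ else 0ℤ

  δ : ∀ {n} → Fin n → Fin n → ℤ
  δ i j = ⟦ does (i ≟ j) ⟧

  δ-refl : ∀ {n} (i : Fin n) → δ i i ≡ 1ℤ
  δ-refl i with i ≟ i
  ... | yes _  = refl
  ... | no i≢i = ⊥-elim (i≢i refl)

  δ-≢ : ∀ {n} {i j : Fin n} → i ≢ j → δ i j ≡ 0ℤ
  δ-≢ {i = i} {j} i≢j with i ≟ j
  ... | yes i≡j = ⊥-elim (i≢j i≡j)
  ... | no _    = refl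

  ∑-δ : ∀ {n} (f : Vector ℤ n) i → ∑[ k < n ] (δ k i * f k) ≡ f i
  ∑-δ f i = trans
    (∑-single _ i λ k k≢i → cong (_* f k) (δ-≢ k≢i))
    (trans (cong (_* f i) (δ-refl i)) (*-identityˡ (f i)))

  Matrix : ℕ → ℕ → Set
  Matrix a b = Fin a → Fin b → ℤ

  does-≟-sym : ∀ {n} (i j : Fin n) → does (i ≟ j) ≡ does (j ≟ i)
  does-≟-sym i j with i ≟ j | j ≟ i
  ... | yes _   | yes _   = refl
  ... | no _    | no _    = refl
  ... | yes i≡j | no j≢i  = ⊥-elim (j≢i (sym i≡j))
  ... | no i≢j  | yes j≡i = ⊥-elim (i≢j (sym j≡i))

  δ-sym : ∀ {n} (i j : Fin n) → δ i j ≡ δ j i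
  δ-sym i j = cong ⟦_⟧ (does-≟-sym i j)

  ∑-δ-row : ∀ {n} (i : Fin n) → ∑[ j < n ] δ i j ≡ 1ℤ
  ∑-δ-row i = trans (∑-single (δ i) i λ j j≢i → δ-≢ (j≢i ∘ sym)) (δ-refl i)

  infixl 7 _⊗_
  infixr 8 _▷_

  _▷_ : ∀ {a b} → Matrix a b → Vector ℤ b → Vector ℤ a
  _▷_ {b = b} A y i = ∑[ j < b ] (A i j * y j)

  -- Defined column by column through `_▷_`, so that facts about matrix-vector products apply to
  -- matrix products by definition.
  _⊗_ : ∀ {a b c} → Matrix a b → Matrix b c → Matrix a c
  (A ⊗ B) i k = (A ▷ λ j → B j k) i

  trace : ∀ {n} → Matrix n n → ℤ
  trace {n} A = ∑[ i < n ] A i i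

  ▷-cong : ∀ {a b} (A : Matrix a b) {y z} → (∀ j → y j ≡ z j) → ∀ i → (A ▷ y) i ≡ (A ▷ z) i
  ▷-cong A y≗z i = sum-cong-≗ λ j → cong (A i j *_) (y≗z j)

  ▷-assoc : ∀ {a b c} (A : Matrix a b) (B : Matrix b c) y i → ((A ⊗ B) ▷ y) i ≡ (A ▷ (B ▷ y)) i
  ▷-assoc {a} {b} {c} A B y i = begin
    ∑[ k < c ] (∑[ j < b ] (A i j * B j k) * y k)
      ≡⟨ sum-cong-≗ (λ k → *-distribʳ-sum (y k) λ j → A i j * B j k) ⟩
    ∑[ k < c ] ∑[ j < b ] (A i j * B j k * y k)
      ≡⟨ ∑-comm (λ k j → A i j * B j k * y k) ⟩
    ∑[ j < b ] ∑[ k < c ] (A i j * B j k * y k)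
      ≡⟨ sum-cong-≗ (λ j → trans (sum-cong-≗ λ k → assoc (A i j) (B j k) (y k))
           (sym (*-distribˡ-sum (A i j) λ k → B j k * y k))) ⟩
    ∑[ j < b ] (A i j * ∑[ k < c ] (B j k * y k)) ∎
    where
    open ≡-Reasoning
    assoc : ∀ x y z → x * y * z ≡ x * (y * z)
    assoc = solve-∀

  ▷-δ : ∀ {a b} (A : Matrix a b) l i → (A ▷ λ j → δ j l) i ≡ A i l
  ▷-δ A l i = trans (sum-cong-≗ λ j → *-comm (A i j) (δ j l)) (∑-δ (A i) l)

  -- Elimination modulo d and the square of the trace

  module _ (d : ℤ) .{{_ : NonZero d}} where

    -- For W = I this says that d divides M². The second matrix makes the induction possible: for an
    -- invertible E, replacing (M, W) by (EM, WE⁻¹) preserves WM and turns MWM into E(MWM), and the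
    -- pair may be rectangular.
    Null : ∀ {a b} → Matrix a b → Matrix b a → Set
    Null M W = ∀ k l → d ∣ (M ⊗ (W ⊗ M)) k l

    TraceSquareDivisible : ∀ {a b} → Matrix a b → Matrix b a → Set
    TraceSquareDivisible M W = d ∣ trace (W ⊗ M) * trace (W ⊗ M)

    -- The inverse column operation on W keeps W ⊗ M unchanged.
    module RowOperation {a b} (M : Matrix a b) (W : Matrix b a) (i : Fin a)
                        (q : Vector ℤ a) (qᵢ≡0 : q i ≡ 0ℤ) where

      M′ : Matrix a b
      M′ k l = M k l - q k * M i l

      W′ : Matrix b a
      W′ l k = W l k + δ k i * (W ▷ q) l

      -- Here M′ = (I - q eᵢᵀ) M and W′ = W (I + q eᵢᵀ). The product (I + q eᵢᵀ)(I - q eᵢᵀ) differs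
      -- from I by the multiple qᵢ of q eᵢᵀ, which vanishes as qᵢ = 0.
      W′⊗M′ : ∀ l l′ → (W′ ⊗ M′) l l′ ≡ (W ⊗ M) l l′
      W′⊗M′ l l′ = begin
        ∑[ k < a ] (W′ l k * M′ k l′)
          ≡⟨ sum-cong-≗ (λ k → expand (W l k) (δ k i) s (M k l′) (q k) (M i l′)) ⟩
        ∑[ k < a ] ((W l k * M k l′ - M i l′ * (W l k * q k)) - (- s) * (δ k i * M′ k l′))
          ≡⟨ ∑-linear (- s) (λ k → W l k * M k l′ - M i l′ * (W l k * q k)) (λ k → δ k i * M′ k l′) ⟩
        ∑[ k < a ] (W l k * M k l′ - M i l′ * (W l k * q k)) - (- s) * ∑[ k < a ] (δ k i * M′ k l′)
          ≡⟨ cong₂ (λ x y → x - (- s) * y)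
               (∑-linear (M i l′) (λ k → W l k * M k l′) (λ k → W l k * q k)) (∑-δ (λ k → M′ k l′) i) ⟩
        ((W ⊗ M) l l′ - M i l′ * s) - (- s) * (M i l′ - q i * M i l′)
          ≡⟨ cong (λ z → ((W ⊗ M) l l′ - M i l′ * s) - (- s) * (M i l′ - z * M i l′)) qᵢ≡0 ⟩
        ((W ⊗ M) l l′ - M i l′ * s) - (- s) * (M i l′ - 0ℤ * M i l′)
          ≡⟨ collapse ((W ⊗ M) l l′) (M i l′) s ⟩
        (W ⊗ M) l l′ ∎
        where
        open ≡-Reasoning
        s = (W ▷ q) l
        expand : ∀ w e s m q m₀ →
          (w + e * s) * (m - q * m₀) ≡ (w * m - m₀ * (w * q)) - (- s) * (e * (m - q * m₀))
        expand = solve-∀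
        collapse : ∀ n m s → (n - m * s) - (- s) * (m - 0ℤ * m) ≡ n
        collapse = solve-∀

      M′▷ : ∀ y k → (M′ ▷ y) k ≡ (M ▷ y) k - q k * (M ▷ y) i
      M′▷ y k = trans
        (sum-cong-≗ λ l → expand (M k l) (q k) (M i l) (y l))
        (∑-linear (q k) (λ l → M k l * y l) (λ l → M i l * y l))
        where
        expand : ∀ m q m₀ y → (m - q * m₀) * y ≡ m * y - q * (m₀ * y)
        expand = solve-∀

      null : Null M W → Null M′ W′
      null MWM k l = subst (d ∣_)
        (sym (trans (▷-cong M′ (λ l′ → W′⊗M′ l′ l) k) (M′▷ (λ l′ → (W ⊗ M) l′ l) k)))
        (∣m∣n⇒∣m-n (MWM k l) (∣n⇒∣m*n (q k) (MWM i l)))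

      reflect : TraceSquareDivisible M′ W′ → TraceSquareDivisible M W
      reflect = subst (λ t → d ∣ t * t) (sum-cong-≗ λ l → W′⊗M′ l l)

    -- Peels off one pivot `g`: row i of M is g r, and M y = g eᵢ. Deleting row i of M and column i
    -- of W subtracts from WM a matrix of rank at most one, and both the divisibility of MWM and the
    -- claim about the trace survive.
    module DropRow {a b} (M : Matrix (suc a) b) (W : Matrix b (suc a)) (i : Fin (suc a))
                   (y : Vector ℤ b) (g : ℤ) (r : Vector ℤ b)
                   (Mᵢ≡gr : ∀ l → M i l ≡ r l * g)
                   (My≡g : (M ▷ y) i ≡ g) (My≡0 : ∀ k → k ≢ i → (M ▷ y) k ≡ 0ℤ)
                   (MWM : Null M W) where

      M′ : Matrix a b
      M′ = M ∘ punchIn i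

      W′ : Matrix b a
      W′ l = W l ∘ punchIn i

      W′⊗M′ : ∀ l l′ → (W′ ⊗ M′) l l′ ≡ (W ⊗ M) l l′ - M i l′ * W l i
      W′⊗M′ l l′ = trans (cancel (W l i) (M i l′) ((W′ ⊗ M′) l l′))
        (cong (_- M i l′ * W l i) (sym (sum-remove {i = i} λ k → W l k * M k l′)))
        where
        cancel : ∀ w m s → s ≡ (w * m + s) - m * w
        cancel = solve-∀

      W▷My : ∀ l → (W ▷ (M ▷ y)) l ≡ W l i * g
      W▷My l = trans
        (∑-single _ i λ k k≢i → trans (cong (W l k *_) (My≡0 k k≢i)) (*-zeroʳ (W l k)))
        (cong (W l i *_) My≡g)

      column : Vector ℤ (suc a)
      column = M ▷ λ l → W l i

      -- With w the i-th column of W, M y = g eᵢ gives MWM y = g M w, and d divides every entry of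
      -- MWM.
      g∣column : ∀ k → d ∣ g * column k
      g∣column k = subst (d ∣_) eq (∣-sum _ λ l → ∣m⇒∣m*n (y l) (MWM k l))
        where
        open ≡-Reasoning
        assoc : ∀ m w g → m * (w * g) ≡ g * (m * w)
        assoc = solve-∀
        eq : ((M ⊗ (W ⊗ M)) ▷ y) k ≡ g * column k
        eq = begin
          ((M ⊗ (W ⊗ M)) ▷ y) k        ≡⟨ ▷-assoc M (W ⊗ M) y k ⟩
          (M ▷ ((W ⊗ M) ▷ y)) k        ≡⟨ ▷-cong M (λ l → trans (▷-assoc W M y l) (W▷My l)) k ⟩
          (M ▷ λ l → W l i * g) k      ≡⟨ sum-cong-≗ (λ l → assoc (M k l) (W l i) g) ⟩
          ∑[ l < b ] (g * (M k l * W l i)) ≡⟨ *-distribˡ-sum g (λ l → M k l * W l i) ⟨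
          g * column k                 ∎

      -- The correction to an entry of MWM is an entry of row i times an entry of `column`. The
      -- former has the factor `g`, so `g∣column` applies.
      null : Null M′ W′
      null k l = subst (d ∣_) (sym eq)
        (∣m∣n⇒∣m-n (MWM k′ l) (subst (d ∣_) (swap g (column k′) (r l)) (∣m⇒∣m*n (r l) (g∣column k′))))
        where
        open ≡-Reasoning
        k′ = punchIn i k
        swap : ∀ g c r → g * c * r ≡ (r * g) * c
        swap = solve-∀
        expand : ∀ m n e w → m * (n - e * w) ≡ m * n - e * (m * w)
        expand = solve-∀
        eq : (M′ ⊗ (W′ ⊗ M′)) k l ≡ (M ⊗ (W ⊗ M)) k′ l - (r l * g) * column k′
        eq = begin
          (M′ ⊗ (W′ ⊗ M′)) k l
            ≡⟨ sum-cong-≗ (λ l′ → trans (cong (M k′ l′ *_) (W′⊗M′ l′ l))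
                 (expand (M k′ l′) ((W ⊗ M) l′ l) (M i l) (W l′ i))) ⟩
          ∑[ l′ < b ] (M k′ l′ * (W ⊗ M) l′ l - M i l * (M k′ l′ * W l′ i))
            ≡⟨ ∑-linear (M i l) (λ l′ → M k′ l′ * (W ⊗ M) l′ l) (λ l′ → M k′ l′ * W l′ i) ⟩
          (M ⊗ (W ⊗ M)) k′ l - M i l * column k′
            ≡⟨ cong (λ z → (M ⊗ (W ⊗ M)) k′ l - z * column k′) (Mᵢ≡gr l) ⟩
          (M ⊗ (W ⊗ M)) k′ l - (r l * g) * column k′ ∎

      trace-split : trace (W ⊗ M) ≡ trace (W′ ⊗ M′) + column i
      trace-split = begin
        trace (W ⊗ M) ≡⟨ add (trace (W ⊗ M)) (column i) ⟩
        (trace (W ⊗ M) - 1ℤ * column i) + column i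
          ≡⟨ cong (_+ column i) (sym (∑-linear 1ℤ (λ l → (W ⊗ M) l l) (λ l → M i l * W l i))) ⟩
        ∑[ l < b ] ((W ⊗ M) l l - 1ℤ * (M i l * W l i)) + column i
          ≡⟨ cong (_+ column i) (sum-cong-≗ λ l → trans
               (cong (λ z → (W ⊗ M) l l - z) (*-identityˡ _)) (sym (W′⊗M′ l l))) ⟩
        trace (W′ ⊗ M′) + column i ∎
        where
        open ≡-Reasoning
        add : ∀ t c → t ≡ (t - 1ℤ * c) + c
        add = solve-∀

      -- One of the two factors is the product of row i = g r with column i of W, so it supplies the
      -- `g` needed for `g∣column`.
      column-square : d ∣ column i * column i
      column-square = subst (d ∣_) (sym eq) (∣m⇒∣m*n (∑[ l < b ] (r l * W l i)) (g∣column i))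
        where
        open ≡-Reasoning
        assoc : ∀ r g w → r * g * w ≡ g * (r * w)
        assoc = solve-∀
        swap : ∀ c g s → c * (g * s) ≡ g * c * s
        swap = solve-∀
        eq : column i * column i ≡ g * column i * ∑[ l < b ] (r l * W l i)
        eq = begin
          column i * column i
            ≡⟨ cong (column i *_) (sum-cong-≗ λ l → trans (cong (_* W l i) (Mᵢ≡gr l))
                 (assoc (r l) g (W l i))) ⟩
          column i * ∑[ l < b ] (g * (r l * W l i))
            ≡⟨ cong (column i *_) (*-distribˡ-sum g λ l → r l * W l i) ⟨
          column i * (g * ∑[ l < b ] (r l * W l i))
            ≡⟨ swap (column i) g (∑[ l < b ] (r l * W l i)) ⟩
          g * column i * ∑[ l < b ] (r l * W l i) ∎

      reflect : TraceSquareDivisible M′ W′ → TraceSquareDivisible M W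
      reflect h = subst (λ t → d ∣ t * t) (sym trace-split)
        (∣-square-+ d (trace (W′ ⊗ M′)) (column i) h column-square)

    ¬∣⇒remainder : ∀ g x .{{_ : NonZero g}} → ¬ g ∣ x →
      ∃[ q ] (x - q * g ≢ 0ℤ × ∣ x - q * g ∣ ℕ.< ∣ g ∣)
    ¬∣⇒remainder g x g∤x = x / g , nonzero , subst (λ z → ∣ z ∣ ℕ.< ∣ g ∣) (sym remainder) (n%d<d x g)
      where
      cancel : ∀ r m → (r + m) - m ≡ r
      cancel = solve-∀
      uncancel : ∀ x m → x ≡ (x - m) + m
      uncancel = solve-∀
      remainder : x - (x / g) * g ≡ + (x % g)
      remainder = trans (cong (_- (x / g) * g) (a≡a%n+[a/n]*n x g)) (cancel (+ (x % g)) ((x / g) * g))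
      nonzero : x - (x / g) * g ≢ 0ℤ
      nonzero eq = g∤x (divides (x / g)
           (trans (uncancel x ((x / g) * g)) (trans (cong (_+ (x / g) * g) eq) (+-identityˡ _))))

    -- Induction on the number of rows of M. Each round removes one row, by `DropRow`, after row
    -- operations have isolated a pivot; the trace loses a summand whose square is divisible by d,
    -- and `∣-square-+` adds it back.
    trace-square-divisible : ∀ a {b} (M : Matrix a b)
         (W : Matrix b a) → Null M W → TraceSquareDivisible M W
    trace-square-divisible zero {b} M W _ =
      divides 0ℤ (cong₂ _*_ (∑-zero (λ (_ : Fin b) → 0ℤ) λ _ → refl) refl)
    trace-square-divisible (suc a) {b} M W MWM with all? (λ l → M zero l ≟ᶻ 0ℤ)
    ... | yes M₀≡0 = D.reflect (trace-square-divisible a D.M′ D.W′ D.null)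
      where
      M0≡0 : ∀ k → (M ▷ λ _ → 0ℤ) k ≡ 0ℤ
      M0≡0 k = ∑-zero _ λ l → *-zeroʳ (M k l)
      -- A zero row is already a pivot row, with g = 0, r = 0 and y = 0.
      module D = DropRow M W zero (λ _ → 0ℤ) 0ℤ (λ _ → 0ℤ) M₀≡0 (M0≡0 zero) (λ k _ → M0≡0 k) MWM
    ... | no M₀≢0 with ¬∀⟶∃¬ b _ (λ l → M zero l ≟ᶻ 0ℤ) M₀≢0
    -- Starting from the unit vector y = eₗ, the first pivot is the nonzero entry `M zero l`.
    ... | l , M₀ₗ≢0 = reduce M W MWM zero (λ j → δ j l) (M₀ₗ≢0 ∘ trans (sym (▷-δ M l zero)))
         (<-wellFounded _)
      where
      -- Euclid's algorithm on the pivot g = (M y)ᵢ: changing y replaces it by a remainder of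
      -- an entry of row i, a row operation by a remainder of an entry of M y.
      reduce : (M : Matrix (suc a) b) (W : Matrix b (suc a)) → Null M W →
               ∀ i y → (M ▷ y) i ≢ 0ℤ → Acc ℕ._<_ ∣ (M ▷ y) i ∣ → TraceSquareDivisible M W
      reduce M W MWM i y g≢0 (acc rec) = row
        where
        g = (M ▷ y) i
        instance
          g-nonZero : NonZero g
          g-nonZero = ≢-nonZero g≢0

        -- If `g` fails to divide some (M y)ₖ, subtracting a multiple of row i from row k leaves the
        -- remainder there, and k becomes the pivot row. Otherwise multiples of row i clear all
        -- other entries of M y, and `DropRow` applies.
        column : (∀ l → g ∣ M i l) → TraceSquareDivisible M W
        column g∣Mᵢ with all? (λ k → g ∣? (M ▷ y) k)
        ... | no g∤My with ¬∀⟶∃¬ (suc a) _ (λ k → g ∣? (M ▷ y) k) g∤My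
        ... | k , g∤Mₖy with ¬∣⇒remainder g _ g∤Mₖy
        ... | q , r≢0 , r< = R.reflect (reduce R.M′ R.W′ (R.null MWM) k y
                (r≢0 ∘ trans (sym eq)) (rec (subst (λ z → ∣ z ∣ ℕ.< ∣ g ∣) (sym eq) r<)))
          where
          k≢i : k ≢ i
          k≢i refl = g∤Mₖy ∣-refl
          module R = RowOperation M W i (λ k′ → δ k′ k * q) (cong (_* q) (δ-≢ (k≢i ∘ sym)))
          eq : (R.M′ ▷ y) k ≡ (M ▷ y) k - q * g
          eq = trans (R.M′▷ y k) (cong (λ z → (M ▷ y) k - z * g)
               (trans (cong (_* q) (δ-refl k)) (*-identityˡ q)))
        column g∣Mᵢ | yes g∣My = R.reflect (D.reflect (trace-square-divisible a D.M′ D.W′ D.null))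
          where
          c : Vector ℤ (suc a)
          -- The factor `1ℤ - δ k i` makes `c` vanish at `i`, as `RowOperation` requires; row i
          -- itself stays unchanged.
          c k = quotient (g∣My k) * (1ℤ - δ k i)
          c≢ : ∀ k → k ≢ i → c k ≡ quotient (g∣My k)
          c≢ k k≢i = trans (cong (λ z → quotient (g∣My k) * (1ℤ - z)) (δ-≢ k≢i))
               (one (quotient (g∣My k)))
            where
            one : ∀ x → x * (1ℤ - 0ℤ) ≡ x
            one = solve-∀
          cᵢ≡0 : c i ≡ 0ℤ
          cᵢ≡0 = trans (cong (λ z → quotient (g∣My i) * (1ℤ - z)) (δ-refl i))
               (*-zeroʳ (quotient (g∣My i)))
          minus-zero : ∀ x y → x - 0ℤ * y ≡ x
          minus-zero = solve-∀
          module R = RowOperation M W i c cᵢ≡0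
          M′y≡0 : ∀ k → k ≢ i → (R.M′ ▷ y) k ≡ 0ℤ
          M′y≡0 k k≢i = trans (R.M′▷ y k)
               (trans (cong₂ (λ u v → u - v * g) (_∣_.equality (g∣My k)) (c≢ k k≢i))
               (self (quotient (g∣My k) * g)))
            where
            self : ∀ x → x - x ≡ 0ℤ
            self = solve-∀
          module D = DropRow R.M′ R.W′ i y g (λ l → quotient (g∣Mᵢ l))
            (λ l → trans (cong (λ z → M i l - z * M i l) cᵢ≡0)
                 (trans (minus-zero (M i l) (M i l)) (_∣_.equality (g∣Mᵢ l))))
            (trans (R.M′▷ y i) (trans (cong (λ z → g - z * g) cᵢ≡0) (minus-zero g g)))
            M′y≡0 (R.null MWM)

        row : TraceSquareDivisible M W
        row with all? (λ l → g ∣? M i l)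
        ... | yes g∣Mᵢ = column g∣Mᵢ
        ... | no g∤Mᵢ with ¬∀⟶∃¬ b _ (λ l → g ∣? M i l) g∤Mᵢ
        ... | l , g∤Mᵢₗ with ¬∣⇒remainder g _ g∤Mᵢₗ
        -- Replacing y by eₗ - q y turns the pivot into Mᵢₗ - q g, the remainder.
        ... | q , r≢0 , r< = reduce M W MWM i (λ j → δ j l - q * y j)
                (r≢0 ∘ trans (sym eq)) (rec (subst (λ z → ∣ z ∣ ℕ.< ∣ g ∣) (sym eq) r<))
          where
          expand : ∀ m e q y → m * (e - q * y) ≡ m * e - q * (m * y)
          expand = solve-∀
          eq : (M ▷ λ j → δ j l - q * y j) i ≡ M i l - q * g
          eq = trans (sum-cong-≗ λ j → expand (M i j) (δ j l) q (y j))
            (trans (∑-linear q (λ j → M i j * δ j l) (λ j → M i j * y j)) (cong (_- q * g) (▷-δ M l i)))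

-- The Seidel matrix of a colouring without books

module SeidelMatrix where

  open import Data.Integer
    using (ℤ; +_; -[1+_]; 0ℤ; 1ℤ; -1ℤ; _+_; _*_; _-_; -_; _≤_; +≤+; NonZero; ≢-nonZero)
  open import Data.Integer.Divisibility.Signed
  open import Data.Integer.Properties
    using (+-injective; *-identityʳ; *-identityˡ; +-identityʳ; +-identityˡ; ≤-reflexive; +-mono-≤;
           i≤j⇒0≤j-i; i*j≡0⇒i≡0∨j≡0; pos-*; *-comm; *-monoˡ-≤-nonNeg)
  open import Data.Integer.Tactic.RingSolver using (solve-∀)
  open IntegerMatrix

  count≡∑ : ∀ {n} {P : Fin n → Set} (P? : Decidable P) → + count P? ≡ ∑[ i < n ] ⟦ does (P? i) ⟧
  count≡∑ {zero}  P? = refl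
  count≡∑ {suc n} P? with does (P? zero)
  ... | true  = cong (λ z → 1ℤ + z) (count≡∑ (P? ∘ suc))
  ... | false = trans (count≡∑ (P? ∘ suc)) (sym (+-identityˡ _))

  -- The quadratic is negative only strictly between -2/3 and 0, where there is no integer. For x =
  -- -(1 + m) it equals (1 + m)(1 + 3m).
  quadratic-nonNeg : ∀ x → 0ℤ ≤ x * (+ 3 * x + + 2)
  quadratic-nonNeg (+ m) = subst (0ℤ ≤_)
    (trans (pos-* m (3 ℕ.* m ℕ.+ 2)) (cong (λ z → + m * (z + + 2)) (pos-* 3 m))) (+≤+ z≤n)
  quadratic-nonNeg -[1+ m ] = subst (0ℤ ≤_)
    (trans (trans (pos-* (1 ℕ.+ m) (1 ℕ.+ 3 ℕ.* m))
         (cong (λ z → (1ℤ + + m) * (1ℤ + z)) (pos-* 3 m))) (reflect (+ m)))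
    (+≤+ z≤n)
    where
    reflect : ∀ m → (1ℤ + m) * (1ℤ + + 3 * m) ≡ (- (1ℤ + m)) * (+ 3 * (- (1ℤ + m)) + + 2)
    reflect = solve-∀

  -- The other root -2/3 would make 3 divide 2.
  quadratic≡0 : ∀ x → x * (+ 3 * x + + 2) ≡ 0ℤ → x ≡ 0ℤ
  quadratic≡0 x eq with i*j≡0⇒i≡0∨j≡0 x eq
  ... | inj₁ x≡0 = x≡0
  ... | inj₂ 3x+2≡0 = ⊥-elim (from-no (+ 3 ∣? + 2)
    (divides (- x) (trans (isolate x) (trans (cong (λ z → z - + 3 * x) 3x+2≡0) (flip x)))))
    where
    isolate : ∀ x → + 2 ≡ (+ 3 * x + + 2) - + 3 * x
    isolate = solve-∀
    flip : ∀ x → 0ℤ - + 3 * x ≡ (- x) * + 3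
    flip = solve-∀

  sign : Color → ℤ
  sign red  = 1ℤ
  sign blue = -1ℤ

  signed : Bool → Color → ℤ
  signed true  _ = 0ℤ
  signed false c = sign c

  sign² : ∀ c → sign c * sign c ≡ 1ℤ
  sign² red  = refl
  sign² blue = refl

  -- Page counts and row sums of the Seidel matrix

  module Seidel {N} (χ : EdgeColoring N) where

    -- The diagonal is set to zero explicitly because `color χ u u` is arbitrary.
    s : Matrix N N
    s u v = signed (does (u ≟ v)) (color χ u v)

    s-refl : ∀ u → s u u ≡ 0ℤ
    s-refl u with u ≟ u
    ... | yes _  = refl
    ... | no u≢u = ⊥-elim (u≢u refl)

    s-≢ : ∀ {u v} → u ≢ v → s u v ≡ sign (color χ u v)
    s-≢ {u} {v} u≢v with u ≟ v
    ... | yes u≡v = ⊥-elim (u≢v u≡v)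
    ... | no _    = refl

    s-sym : ∀ u v → s u v ≡ s v u
    s-sym u v = cong₂ signed (does-≟-sym u v) (color-symm χ u v)

    t : Vector ℤ N
    t u = ∑[ v < N ] s u v

    -- Written as S Sᵀ, which is S² because S is symmetric; the sum over w then runs along two rows.
    s² : Matrix N N
    s² u v = ∑[ w < N ] (s u w * s v w)

    s²-diagonal : ∀ u → s² u u ≡ + N - 1ℤ
    s²-diagonal u = begin
      ∑[ w < N ] (s u w * s u w)
        ≡⟨ sum-cong-≗ term ⟩
      ∑[ w < N ] (1ℤ - 1ℤ * δ u w)
        ≡⟨ ∑-linear 1ℤ (λ _ → 1ℤ) (δ u) ⟩
      ∑[ w < N ] 1ℤ - 1ℤ * ∑[ w < N ] δ u w
        ≡⟨ cong₂ (λ x y → x - 1ℤ * y) (trans (∑-const N 1ℤ) (*-identityʳ (+ N))) (∑-δ-row u) ⟩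
      + N - 1ℤ ∎
      where
      open ≡-Reasoning
      term : ∀ w → s u w * s u w ≡ 1ℤ - 1ℤ * δ u w
      term w with u ≟ w
      ... | yes _ = refl
      ... | no _  = sign² (color χ u w)

    -- For σ the sign of uv and w different from u and v, (1 + σ s_uw)(1 + σ s_vw) is 4 if w is a
    -- page and 0 otherwise. Expanded using σ² = 1, the expression takes the value 2 at w = u and at
    -- w = v, which the two deltas remove; this is the total correction -4.
    pages-sign : ∀ {u v} → u ≢ v → + 4 * + pages χ (color χ u v) u v
      ≡ s² u v + s u v * (t u + t v) + + N - + 4
    pages-sign {u} {v} u≢v = begin
      + 4 * + pages χ c u v
        ≡⟨ cong (λ z → + 4 * z) (count≡∑ (page? χ c u v)) ⟩
      + 4 * ∑[ w < N ] ⟦ does (page? χ c u v w) ⟧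
        ≡⟨ *-distribˡ-sum (+ 4) (λ w → ⟦ does (page? χ c u v w) ⟧) ⟩
      ∑[ w < N ] (+ 4 * ⟦ does (page? χ c u v w) ⟧)
        ≡⟨ sum-cong-≗ term ⟩
      ∑[ w < N ] (s u w * s v w + sign c * (s u w + s v w) + 1ℤ - + 2 * (δ u w + δ v w))
        ≡⟨ ∑-linear (+ 2) (λ w → s u w * s v w + sign c * (s u w + s v w) + 1ℤ) (λ w → δ u w + δ v w) ⟩
      ∑[ w < N ] (s u w * s v w + sign c * (s u w + s v w) + 1ℤ) - + 2 * ∑[ w < N ] (δ u w + δ v w)
        ≡⟨ cong₂ (λ x y → x - + 2 * y) leading diagonal ⟩
      s² u v + s u v * (t u + t v) + + N - + 4 ∎
      where
      open ≡-Reasoning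
      c = color χ u v
      distinct : ∀ a b c → + 4 * ⟦ does (a ≟ᶜ c) ∧ does (b ≟ᶜ c) ⟧
        ≡ sign a * sign b + sign c * (sign a + sign b) + 1ℤ - + 2 * (0ℤ + 0ℤ)
      distinct red  red  red  = refl
      distinct red  red  blue = refl
      distinct red  blue red  = refl
      distinct red  blue blue = refl
      distinct blue red  red  = refl
      distinct blue red  blue = refl
      distinct blue blue red  = refl
      distinct blue blue blue = refl
      leftEnd : ∀ c → 0ℤ ≡ 0ℤ * sign c + sign c * (0ℤ + sign c) + 1ℤ - + 2 * (1ℤ + 0ℤ)
      leftEnd red  = refl
      leftEnd blue = refl
      rightEnd : ∀ b c → + 4 * ⟦ does (b ≟ᶜ c) ∧ false ⟧ ≡
        sign b * 0ℤ + sign b * (sign b + 0ℤ) + 1ℤ - + 2 * (0ℤ + 1ℤ)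
      rightEnd red  red  = refl
      rightEnd red  blue = refl
      rightEnd blue red  = refl
      rightEnd blue blue = refl
      term : ∀ w → + 4 * ⟦ does (page? χ c u v w) ⟧
        ≡ s u w * s v w + sign c * (s u w + s v w) + 1ℤ - + 2 * (δ u w + δ v w)
      term w with u ≟ w | v ≟ w
      ... | yes refl | yes refl = ⊥-elim (u≢v refl)
      ... | yes refl | no _     = trans (leftEnd (color χ u v))
        (cong (λ e → 0ℤ * sign e + sign (color χ u v) * (0ℤ + sign e) + 1ℤ - + 2 * (1ℤ + 0ℤ))
             (color-symm χ u v))
      ... | no _     | yes refl = rightEnd (color χ u v) (color χ u v)
      ... | no _     | no _     = distinct (color χ u w) (color χ v w) c
      leading : ∑[ w < N ] (s u w * s v w + sign c * (s u w + s v w) + 1ℤ)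
        ≡ s² u v + s u v * (t u + t v) + + N
      leading = begin
        ∑[ w < N ] (s u w * s v w + sign c * (s u w + s v w) + 1ℤ)
          ≡⟨ ∑-distrib-+ (λ w → s u w * s v w + sign c * (s u w + s v w)) (λ _ → 1ℤ) ⟩
        ∑[ w < N ] (s u w * s v w + sign c * (s u w + s v w)) + ∑[ w < N ] 1ℤ
          ≡⟨ cong₂ _+_ (∑-distrib-+ (λ w → s u w * s v w) (λ w → sign c * (s u w + s v w)))
                       (trans (∑-const N 1ℤ) (*-identityʳ (+ N))) ⟩
        s² u v + ∑[ w < N ] (sign c * (s u w + s v w)) + + N
          ≡⟨ cong (λ z → s² u v + z + + N) (sym (*-distribˡ-sum (sign c) λ w → s u w + s v w)) ⟩
        s² u v + sign c * ∑[ w < N ] (s u w + s v w) + + N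
          ≡⟨ cong₂ (λ x y → s² u v + x * y + + N) (sym (s-≢ u≢v)) (∑-distrib-+ (s u) (s v)) ⟩
        s² u v + s u v * (t u + t v) + + N ∎
      diagonal : ∑[ w < N ] (δ u w + δ v w) ≡ + 2
      diagonal = trans (∑-distrib-+ (δ u) (δ v)) (cong₂ _+_ (∑-δ-row u) (∑-δ-row v))

    -- The row sum is the red degree minus the blue degree, and the two degrees add up to N - 1.
    t-redDegree : ∀ u → t u ≡ + 2 * ∑[ v < N ] ⟦ not (does (u ≟ v)) ∧ isRed (color χ u v) ⟧ + 1ℤ - + N
    t-redDegree u = begin
      ∑[ v < N ] s u v
        ≡⟨ sum-cong-≗ term ⟩
      ∑[ v < N ] (+ 2 * ρ v + δ u v - 1ℤ * 1ℤ)
        ≡⟨ ∑-linear 1ℤ (λ v → + 2 * ρ v + δ u v) (λ _ → 1ℤ) ⟩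
      ∑[ v < N ] (+ 2 * ρ v + δ u v) - 1ℤ * ∑[ v < N ] 1ℤ
        ≡⟨ cong₂ _-_ (∑-distrib-+ (λ v → + 2 * ρ v) (δ u))
             (trans (*-identityˡ _) (trans (∑-const N 1ℤ) (*-identityʳ (+ N)))) ⟩
      ∑[ v < N ] (+ 2 * ρ v) + ∑[ v < N ] δ u v - + N
        ≡⟨ cong₂ (λ x y → x + y - + N) (sym (*-distribˡ-sum (+ 2) ρ)) (∑-δ-row u) ⟩
      + 2 * sum ρ + 1ℤ - + N ∎
      where
      open ≡-Reasoning
      ρ : Vector ℤ N
      ρ v = ⟦ not (does (u ≟ v)) ∧ isRed (color χ u v) ⟧
      term : ∀ v → s u v ≡ + 2 * ρ v + δ u v - 1ℤ * 1ℤ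
      term v with u ≟ v
      ... | yes _ = refl
      ... | no _ with color χ u v
      ... | red  = refl
      ... | blue = refl

    -- Summing over u and v first, for fixed w, gives the square of a column sum, and column sums
    -- are row sums.
    ∑∑s² : ∑[ u < N ] ∑[ v < N ] s² u v ≡ ∑[ w < N ] (t w * t w)
    ∑∑s² = begin
      ∑[ u < N ] ∑[ v < N ] ∑[ w < N ] (s u w * s v w)
        ≡⟨ sum-cong-≗ (λ u → ∑-comm λ v w → s u w * s v w) ⟩
      ∑[ u < N ] ∑[ w < N ] ∑[ v < N ] (s u w * s v w)
        ≡⟨ sum-cong-≗ (λ u → sum-cong-≗ λ w → trans (sym (*-distribˡ-sum (s u w) λ v → s v w))
             (cong (λ z → s u w * z) (column w))) ⟩
      ∑[ u < N ] ∑[ w < N ] (s u w * t w)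
        ≡⟨ ∑-comm (λ u w → s u w * t w) ⟩
      ∑[ w < N ] ∑[ u < N ] (s u w * t w)
        ≡⟨ sum-cong-≗ (λ w → trans (sym (*-distribʳ-sum (t w) λ u → s u w))
             (cong (λ z → z * t w) (column w))) ⟩
      ∑[ w < N ] (t w * t w) ∎
      where
      open ≡-Reasoning
      column : ∀ w → ∑[ v < N ] s v w ≡ t w
      column w = sum-cong-≗ λ v → s-sym v w

    ∑∑st : ∑[ u < N ] ∑[ v < N ] (s u v * (t u + t v)) ≡ ∑[ w < N ] (+ 2 * (t w * t w))
    ∑∑st = begin
      ∑[ u < N ] ∑[ v < N ] (s u v * (t u + t v))
        ≡⟨ sum-cong-≗ (λ u → trans (sum-cong-≗ λ v → distrib (s u v) (t u) (t v))
             (∑-distrib-+ (λ v → s u v * t u) (λ v → s u v * t v))) ⟩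
      ∑[ u < N ] (∑[ v < N ] (s u v * t u) + ∑[ v < N ] (s u v * t v))
        ≡⟨ ∑-distrib-+ (λ u → ∑[ v < N ] (s u v * t u)) (λ u → ∑[ v < N ] (s u v * t v)) ⟩
      ∑[ u < N ] ∑[ v < N ] (s u v * t u) + ∑[ u < N ] ∑[ v < N ] (s u v * t v)
        ≡⟨ cong₂ _+_ (sum-cong-≗ λ u → sym (*-distribʳ-sum (t u) (s u))) (∑-comm λ u v → s u v * t v) ⟩
      ∑[ u < N ] (t u * t u) + ∑[ v < N ] ∑[ u < N ] (s u v * t v)
        ≡⟨ cong (λ z → ∑[ u < N ] (t u * t u) + z)
             (sum-cong-≗ λ v → trans (sum-cong-≗ λ u → cong (λ z → z * t v) (s-sym u v))
             (sym (*-distribʳ-sum (t v) (s v)))) ⟩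
      ∑[ u < N ] (t u * t u) + ∑[ v < N ] (t v * t v)
        ≡⟨ ∑-distrib-+ (λ u → t u * t u) (λ u → t u * t u) ⟨
      ∑[ w < N ] (t w * t w + t w * t w)
        ≡⟨ sum-cong-≗ (λ w → double (t w * t w)) ⟩
      ∑[ w < N ] (+ 2 * (t w * t w)) ∎
      where
      open ≡-Reasoning
      distrib : ∀ a x y → a * (x + y) ≡ a * x + a * y
      distrib = solve-∀
      double : ∀ x → x + x ≡ + 2 * x
      double = solve-∀

  -- ν is n - 2: a red edge lies in at most n - 3 red triangles, a blue edge in at
  -- most n - 1 blue ones.
  module Extremal {N} (χ : EdgeColoring N) (ν : ℤ) (N≡4ν+5 : + N ≡ + 4 * ν + + 5)
    (few : ∀ u v → u ≢ v → + pages χ (color χ u v) u v ≤ ν - sign (color χ u v)) where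

    open Seidel χ

    -- Off the diagonal this is four times the number of missing pages. The term `+ N * δ u v` makes
    -- the diagonal vanish, so that sums may run over all pairs.
    slack : Matrix N N
    slack u v = + N * δ u v - 1ℤ - + 4 * s u v - (s² u v + s u v * (t u + t v))

    slack-≢ : ∀ {u v} → u ≢ v → slack u v ≡ + 4 * (ν - sign (color χ u v) - + pages χ (color χ u v) u v)
    slack-≢ {u} {v} u≢v = begin
      + N * δ u v - 1ℤ - + 4 * s u v - (s² u v + s u v * (t u + t v))
        ≡⟨ cong₂ (λ x y → + N * x - 1ℤ - + 4 * y - (s² u v + s u v * (t u + t v))) (δ-≢ u≢v) (s-≢ u≢v) ⟩
      + N * 0ℤ - 1ℤ - + 4 * σ - (s² u v + s u v * (t u + t v))
        ≡⟨ step (+ N) σ (s² u v + s u v * (t u + t v)) ⟩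
      (+ N - + 5) - + 4 * σ - (s² u v + s u v * (t u + t v) + + N - + 4)
        ≡⟨ cong₂ (λ x y → (x - + 5) - + 4 * σ - y) N≡4ν+5 (sym (pages-sign u≢v)) ⟩
      (+ 4 * ν + + 5 - + 5) - + 4 * σ - + 4 * + pages χ (color χ u v) u v
        ≡⟨ factor ν σ (+ pages χ (color χ u v) u v) ⟩
      + 4 * (ν - σ - + pages χ (color χ u v) u v) ∎
      where
      open ≡-Reasoning
      σ = sign (color χ u v)
      step : ∀ n σ x → n * 0ℤ - 1ℤ - + 4 * σ - x ≡ (n - + 5) - + 4 * σ - (x + n - + 4)
      step = solve-∀
      factor : ∀ ν σ p → (+ 4 * ν + + 5 - + 5) - + 4 * σ - + 4 * p ≡ + 4 * (ν - σ - p)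
      factor = solve-∀

    slack-refl : ∀ u → slack u u ≡ 0ℤ
    slack-refl u = trans
      (trans (cong₂ (λ x y → + N * x - 1ℤ - + 4 * y - (s² u u + y * (t u + t u))) (δ-refl u) (s-refl u))
             (cong (λ x → + N * 1ℤ - 1ℤ - + 4 * 0ℤ - (x + 0ℤ * (t u + t u))) (s²-diagonal u)))
      (cancel (+ N) (t u))
      where
      cancel : ∀ n t → n * 1ℤ - 1ℤ - + 4 * 0ℤ - (n - 1ℤ + 0ℤ * (t + t)) ≡ 0ℤ
      cancel = solve-∀

    slack-nonNeg : ∀ u v → 0ℤ ≤ slack u v
    slack-nonNeg u v = case u ≟ v of λ where
      (yes refl) → ≤-reflexive (sym (slack-refl u))
      (no u≢v)   → subst (0ℤ ≤_) (sym (slack-≢ u≢v))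
        (*-monoˡ-≤-nonNeg (+ 4) (i≤j⇒0≤j-i (few u v u≢v)))

    -- In each row the N from the delta cancels the N copies of -1. The coefficient 3 is 1 from
    -- `∑∑s²` plus 2 from `∑∑st`.
    ∑slack : ∑[ u < N ] ∑[ v < N ] slack u v ≡ ∑[ u < N ] (- (+ 4 * t u + + 3 * (t u * t u)))
    ∑slack = begin
      ∑[ u < N ] ∑[ v < N ] slack u v
        ≡⟨ sum-cong-≗ row ⟩
      ∑[ u < N ] (- (+ 4 * t u) - 1ℤ * Q u)
        ≡⟨ ∑-linear 1ℤ (λ u → - (+ 4 * t u)) Q ⟩
      ∑[ u < N ] (- (+ 4 * t u)) - 1ℤ * sum Q
        ≡⟨ cong (λ z → ∑[ u < N ] (- (+ 4 * t u)) - 1ℤ * z) ∑Q ⟩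
      ∑[ u < N ] (- (+ 4 * t u)) - 1ℤ * ∑[ u < N ] (t u * t u + + 2 * (t u * t u))
        ≡⟨ ∑-linear 1ℤ (λ u → - (+ 4 * t u)) (λ u → t u * t u + + 2 * (t u * t u)) ⟨
      ∑[ u < N ] (- (+ 4 * t u) - 1ℤ * (t u * t u + + 2 * (t u * t u)))
        ≡⟨ sum-cong-≗ (λ u → collect (t u)) ⟩
      ∑[ u < N ] (- (+ 4 * t u + + 3 * (t u * t u))) ∎
      where
      open ≡-Reasoning
      collect : ∀ t → - (+ 4 * t) - 1ℤ * (t * t + + 2 * (t * t)) ≡ - (+ 4 * t + + 3 * (t * t))
      collect = solve-∀
      R : Fin N → Fin N → ℤ
      R u v = s² u v + s u v * (t u + t v)
      Q : Vector ℤ N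
      Q u = ∑[ v < N ] R u v
      ∑Q : sum Q ≡ ∑[ u < N ] (t u * t u + + 2 * (t u * t u))
      ∑Q = begin
        ∑[ u < N ] ∑[ v < N ] R u v
          ≡⟨ sum-cong-≗ (λ u → ∑-distrib-+ (s² u) (λ v → s u v * (t u + t v))) ⟩
        ∑[ u < N ] (∑[ v < N ] s² u v + ∑[ v < N ] (s u v * (t u + t v)))
          ≡⟨ ∑-distrib-+ (λ u → ∑[ v < N ] s² u v) (λ u → ∑[ v < N ] (s u v * (t u + t v))) ⟩
        ∑[ u < N ] ∑[ v < N ] s² u v + ∑[ u < N ] ∑[ v < N ] (s u v * (t u + t v))
          ≡⟨ cong₂ _+_ ∑∑s² ∑∑st ⟩
        ∑[ u < N ] (t u * t u) + ∑[ u < N ] (+ 2 * (t u * t u))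
          ≡⟨ ∑-distrib-+ (λ u → t u * t u) (λ u → + 2 * (t u * t u)) ⟨
        ∑[ u < N ] (t u * t u + + 2 * (t u * t u)) ∎
      row : ∀ u → ∑[ v < N ] slack u v ≡ - (+ 4 * t u) - 1ℤ * Q u
      row u = begin
        ∑[ v < N ] slack u v
          ≡⟨ sum-cong-≗ (λ v → unit (+ N * δ u v - 1ℤ - + 4 * s u v) (R u v)) ⟩
        ∑[ v < N ] (+ N * δ u v - 1ℤ - + 4 * s u v - 1ℤ * R u v)
          ≡⟨ ∑-linear 1ℤ (λ v → + N * δ u v - 1ℤ - + 4 * s u v) (R u) ⟩
        ∑[ v < N ] (+ N * δ u v - 1ℤ - + 4 * s u v) - 1ℤ * Q u
          ≡⟨ cong (λ z → z - 1ℤ * Q u) (∑-linear (+ 4) (λ v → + N * δ u v - 1ℤ) (s u)) ⟩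
        ∑[ v < N ] (+ N * δ u v - 1ℤ) - + 4 * t u - 1ℤ * Q u
          ≡⟨ cong (λ z → z - + 4 * t u - 1ℤ * Q u) (∑-linear 1ℤ (λ v → + N * δ u v) (λ _ → 1ℤ)) ⟩
        ∑[ v < N ] (+ N * δ u v) - 1ℤ * ∑[ v < N ] 1ℤ - + 4 * t u - 1ℤ * Q u
          ≡⟨ cong₂ (λ x y → x - 1ℤ * y - + 4 * t u - 1ℤ * Q u)
               (trans (sym (*-distribˡ-sum (+ N) (δ u))) (cong (λ z → + N * z) (∑-δ-row u)))
                    (∑-const N 1ℤ) ⟩
        + N * 1ℤ - 1ℤ * (+ N * 1ℤ) - + 4 * t u - 1ℤ * Q u
          ≡⟨ cancel (+ N) (t u) (Q u) ⟩
        - (+ 4 * t u) - 1ℤ * Q u ∎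
        where
        unit : ∀ x y → x - y ≡ x - 1ℤ * y
        unit = solve-∀
        cancel : ∀ n t q → n * 1ℤ - 1ℤ * (n * 1ℤ) - + 4 * t - 1ℤ * q ≡ - (+ 4 * t) - 1ℤ * q
        cancel = solve-∀

    -- Red degree minus (N - 1) / 2; this is where the parity of N enters.
    excess : Vector ℤ N
    excess u = ∑[ v < N ] ⟦ not (does (u ≟ v)) ∧ isRed (color χ u v) ⟧ - + 2 * ν - + 2

    t≡2excess : ∀ u → t u ≡ + 2 * excess u
    t≡2excess u = trans (t-redDegree u) (trans (cong (λ z → + 2 * D + 1ℤ - z) N≡4ν+5) (halve D ν))
      where
      D = ∑[ v < N ] ⟦ not (does (u ≟ v)) ∧ isRed (color χ u v) ⟧
      halve : ∀ D ν → + 2 * D + 1ℤ - (+ 4 * ν + + 5) ≡ + 2 * (D - + 2 * ν - + 2)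
      halve = solve-∀

    weight : Vector ℤ N
    weight u = + 4 * t u + + 3 * (t u * t u)

    -- Evenness of the row sum is essential for nonnegativity: 4t + 3t² is -1 at t = -1.
    weight≡ : ∀ u → weight u ≡ + 4 * (excess u * (+ 3 * excess u + + 2))
    weight≡ u = trans (cong (λ z → + 4 * z + + 3 * (z * z)) (t≡2excess u)) (factor (excess u))
      where
      factor : ∀ x → + 4 * (+ 2 * x) + + 3 * (+ 2 * x * (+ 2 * x)) ≡ + 4 * (x * (+ 3 * x + + 2))
      factor = solve-∀

    weight-nonNeg : ∀ u → 0ℤ ≤ weight u
    weight-nonNeg u = subst (0ℤ ≤_) (sym (weight≡ u))
         (*-monoˡ-≤-nonNeg (+ 4) (quadratic-nonNeg (excess u)))

    balance : ∑[ u < N ] (∑[ v < N ] slack u v + weight u) ≡ 0ℤ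
    balance = begin
      ∑[ u < N ] (∑[ v < N ] slack u v + weight u)
        ≡⟨ ∑-distrib-+ (λ u → ∑[ v < N ] slack u v) weight ⟩
      ∑[ u < N ] ∑[ v < N ] slack u v + sum weight
        ≡⟨ cong (λ z → z + sum weight) ∑slack ⟩
      ∑[ u < N ] (- weight u) + sum weight
        ≡⟨ ∑-distrib-+ (λ u → - weight u) weight ⟨
      ∑[ u < N ] (- weight u + weight u)
        ≡⟨ ∑-zero _ (λ u → cancel (weight u)) ⟩
      0ℤ ∎
      where
      open ≡-Reasoning
      cancel : ∀ x → - x + x ≡ 0ℤ
      cancel = solve-∀

    -- By `balance` the nonnegative row slacks and weights add up to zero, so each of them is zero.
    tight : ∀ u → ∑[ v < N ] slack u v ≡ 0ℤ × weight u ≡ 0ℤ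
    tight u = nonNeg-+≡0 (∑-nonNeg (slack u) (slack-nonNeg u)) (weight-nonNeg u)
      (∑-nonNeg≡0 _ (λ u → +-mono-≤ (∑-nonNeg (slack u) (slack-nonNeg u)) (weight-nonNeg u)) balance u)

    slack≡0 : ∀ u v → slack u v ≡ 0ℤ
    slack≡0 u = ∑-nonNeg≡0 (slack u) (slack-nonNeg u) (proj₁ (tight u))

    t≡0 : ∀ u → t u ≡ 0ℤ
    t≡0 u = trans (t≡2excess u) (cong (λ z → + 2 * z) (quadratic≡0 (excess u) root))
      where
      root : excess u * (+ 3 * excess u + + 2) ≡ 0ℤ
      root = case i*j≡0⇒i≡0∨j≡0 (+ 4) (trans (sym (weight≡ u)) (proj₂ (tight u))) of λ where
        (inj₂ eq) → eq

    -- The quadratic equation of the Seidel matrix and its trace obstruction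

    s²≡ : ∀ u v → s² u v ≡ + N * δ u v - 1ℤ - + 4 * s u v
    s²≡ u v = begin
      s² u v
        ≡⟨ isolate (s² u v) (s u v) (+ N * δ u v - 1ℤ - + 4 * s u v) ⟩
      (+ N * δ u v - 1ℤ - + 4 * s u v) - (+ N * δ u v - 1ℤ - + 4 * s u v - (s² u v + s u v * (0ℤ + 0ℤ)))
        ≡⟨ cong₂ (λ y z → (+ N * δ u v - 1ℤ - + 4 * s u v) -
             (+ N * δ u v - 1ℤ - + 4 * s u v - (s² u v + s u v * (y + z))))
             (sym (t≡0 u)) (sym (t≡0 v)) ⟩
      (+ N * δ u v - 1ℤ - + 4 * s u v) - slack u v
        ≡⟨ cong (λ z → (+ N * δ u v - 1ℤ - + 4 * s u v) - z) (slack≡0 u v) ⟩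
      (+ N * δ u v - 1ℤ - + 4 * s u v) - 0ℤ
        ≡⟨ +-identityʳ _ ⟩
      + N * δ u v - 1ℤ - + 4 * s u v ∎
      where
      open ≡-Reasoning
      isolate : ∀ q s r → q ≡ r - (r - (q + s * (0ℤ + 0ℤ)))
      isolate = solve-∀

    -- Completing the square in S² = N I - J - 4S gives (S + 2I)² = d I - J with d = N + 4. Since SJ
    -- = 0, adding J to 2(S + 2I) changes the coefficient of J in the square from -4 to N + 4, so
    -- that d divides the whole square.
    X : Matrix N N
    X u v = + 2 * s u v + 1ℤ + + 4 * δ u v

    X-sym : ∀ u v → X u v ≡ X v u
    X-sym u v = cong₂ (λ y z → + 2 * y + 1ℤ + + 4 * z) (s-sym u v) (δ-sym u v)

    X²≡ : ∀ u v → (X ⊗ X) u v ≡ (+ N + + 4) * (1ℤ + + 4 * δ u v)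
    X²≡ u v = begin
      ∑[ w < N ] (X u w * X w v)
        ≡⟨ sum-cong-≗ (λ w → trans (cong (λ z → X u w * z) (X-sym w v))
             (trans (expand (s u w) (s v w) (δ u w) (δ v w))
             (cong₂ (λ y z → B w + + 4 * (y * (+ 2 * s v w + 1ℤ + + 4 * δ v w))
                  + + 4 * (z * (+ 2 * s u w + 1ℤ))) (δ-sym u w) (δ-sym v w)))) ⟩
      ∑[ w < N ] (B w + + 4 * (δ w u * X v w) + + 4 * (δ w v * (+ 2 * s u w + 1ℤ)))
        ≡⟨ ∑-distrib-+ (λ w → B w + + 4 * (δ w u * X v w)) (λ w → + 4 * (δ w v * (+ 2 * s u w + 1ℤ))) ⟩
      ∑[ w < N ] (B w + + 4 * (δ w u * X v w)) + ∑[ w < N ] (+ 4 * (δ w v * (+ 2 * s u w + 1ℤ)))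
        ≡⟨ cong₂ _+_ (∑-distrib-+ B (λ w → + 4 * (δ w u * X v w))) (pick (λ w → + 2 * s u w + 1ℤ) v) ⟩
      sum B + ∑[ w < N ] (+ 4 * (δ w u * X v w)) + + 4 * (+ 2 * s u v + 1ℤ)
        ≡⟨ cong₂ (λ y z → y + z + + 4 * (+ 2 * s u v + 1ℤ)) ∑B
             (trans (pick (X v) u) (cong (λ z → + 4 * z) (X-sym v u))) ⟩
      + 4 * s² u v + + 2 * (t u + t v) + + N + + 4 * X u v + + 4 * (+ 2 * s u v + 1ℤ)
        ≡⟨ cong₂ (λ y z → + 4 * y + + 2 * z + + N + + 4 * X u v + + 4 * (+ 2 * s u v + 1ℤ))
             (s²≡ u v) (cong₂ _+_ (t≡0 u) (t≡0 v)) ⟩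
      + 4 * (+ N * δ u v - 1ℤ - + 4 * s u v) + + 2 * (0ℤ + 0ℤ) + + N + + 4 * X u v
        + + 4 * (+ 2 * s u v + 1ℤ)
        ≡⟨ collect (+ N) (s u v) (δ u v) ⟩
      (+ N + + 4) * (1ℤ + + 4 * δ u v) ∎
      where
      open ≡-Reasoning
      B : Vector ℤ N
      -- The part of the summand free of deltas; the remaining terms are evaluated by `pick`.
      B w = + 4 * (s u w * s v w) + + 2 * (s u w + s v w) + 1ℤ
      expand : ∀ a b e f → (+ 2 * a + 1ℤ + + 4 * e) * (+ 2 * b + 1ℤ + + 4 * f) ≡
        (+ 4 * (a * b) + + 2 * (a + b) + 1ℤ) + + 4 * (e * (+ 2 * b + 1ℤ + + 4 * f))
          + + 4 * (f * (+ 2 * a + 1ℤ))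
      expand = solve-∀
      collect : ∀ n s e → + 4 * (n * e - 1ℤ - + 4 * s) + + 2 * (0ℤ + 0ℤ) + n
        + + 4 * (+ 2 * s + 1ℤ + + 4 * e) + + 4 * (+ 2 * s + 1ℤ)
        ≡ (n + + 4) * (1ℤ + + 4 * e)
      collect = solve-∀
      pick : ∀ f i → ∑[ w < N ] (+ 4 * (δ w i * f w)) ≡ + 4 * f i
      pick f i = trans (sym (*-distribˡ-sum (+ 4) λ w → δ w i * f w)) (cong (λ z → + 4 * z) (∑-δ f i))
      ∑B : sum B ≡ + 4 * s² u v + + 2 * (t u + t v) + + N
      ∑B = begin
        sum B
          ≡⟨ ∑-distrib-+ (λ w → + 4 * (s u w * s v w) + + 2 * (s u w + s v w)) (λ _ → 1ℤ) ⟩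
        ∑[ w < N ] (+ 4 * (s u w * s v w) + + 2 * (s u w + s v w)) + ∑[ w < N ] 1ℤ
          ≡⟨ cong₂ _+_ (∑-distrib-+ (λ w → + 4 * (s u w * s v w)) (λ w → + 2 * (s u w + s v w)))
               (trans (∑-const N 1ℤ) (*-identityʳ (+ N))) ⟩
        ∑[ w < N ] (+ 4 * (s u w * s v w)) + ∑[ w < N ] (+ 2 * (s u w + s v w)) + + N
          ≡⟨ cong₂ (λ y z → y + z + + N) (sym (*-distribˡ-sum (+ 4) λ w → s u w * s v w))
               (trans (sym (*-distribˡ-sum (+ 2) λ w → s u w + s v w))
                    (cong (λ z → + 2 * z) (∑-distrib-+ (s u) (s v)))) ⟩
        + 4 * s² u v + + 2 * (t u + t v) + + N ∎

    -- The identity matrix is written with `δ j i` because `∑-δ` sums over the first index of the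
    -- delta.
    I⊗X : ∀ u v → ((λ i j → δ j i) ⊗ X) u v ≡ X u v
    I⊗X u v = ∑-δ (λ w → X w v) u

    trace-X : trace ((λ i j → δ j i) ⊗ X) ≡ + N * + 5
    trace-X = trans (sum-cong-≗ λ u → trans (I⊗X u u)
         (cong₂ (λ y z → + 2 * y + 1ℤ + + 4 * z) (s-refl u) (δ-refl u)))
      (∑-const N (+ 5))

    N+4∣400 : (N ℕ.+ 4) ℕ.∣ 400
    -- Modulo d the number N is -4, so 25 N² leaves 25 · 16 = 400.
    N+4∣400 = ∣⇒∣ᵤ (∣m+n∣m⇒∣n (subst (d ∣_) (square (+ N)) d∣25N²)
         (∣m⇒∣m*n (+ 25 * (+ N - + 4)) ∣-refl))
      where
      d = + N + + 4
      instance
        d-nonZero : NonZero d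
        d-nonZero = ≢-nonZero {i = d} λ eq → ℕ.m+1+n≢0 N (+-injective eq)
      null : Null d X (λ i j → δ j i)
      null u v = divides (1ℤ + + 4 * δ u v)
        (trans (▷-cong X (λ w → I⊗X w v) u) (trans (X²≡ u v) (*-comm d (1ℤ + + 4 * δ u v))))
      d∣25N² : d ∣ (+ N * + 5) * (+ N * + 5)
      d∣25N² = subst (λ z → d ∣ z * z) trace-X (trace-square-divisible d N X (λ i j → δ j i) null)
      square : ∀ n → n * + 5 * (n * + 5) ≡ (n + + 4) * (+ 25 * (n - + 4)) + + 400
      square = solve-∀

  -- The odd divisors of 400 are 1, 5 and 25, and only 25 is at least 13. Formally, a divisor is at
  -- most 400 = 4 · 100, so k < 100, and these cases are decided by evaluation.
  4k+13∣400⇒k≡3 : ∀ k → 4 ℕ.* k ℕ.+ 9 ℕ.+ 4 ℕ.∣ 400 → k ≡ 3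
  4k+13∣400⇒k≡3 k d∣400 = subst (λ j → 4 ℕ.* j ℕ.+ 9 ℕ.+ 4 ℕ.∣ 400 → j ≡ 3) (toℕ-fromℕ< k<100)
    (table (fromℕ< k<100)) d∣400
    where
    k<100 : k ℕ.< 100
    k<100 = ℕ.*-cancelˡ-< 4 k 100 (ℕ.<-≤-trans
      (ℕ.<-≤-trans (ℕ.m<m+n (4 ℕ.* k) (s≤s z≤n)) (ℕ.m≤m+n (4 ℕ.* k ℕ.+ 9) 4)) (ℕ.∣⇒≤ d∣400))
    table : ∀ (j : Fin 100) → 4 ℕ.* toℕ j ℕ.+ 9 ℕ.+ 4 ℕ.∣ 400 → toℕ j ≡ 3
    table = from-yes (all? {n = 100} λ j → (4 ℕ.* toℕ j ℕ.+ 9 ℕ.+ 4 ℕ.∣? 400) →-dec (toℕ j ℕ.≟ 3))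

  arrows : ∀ k → k ≢ 3 → Arrows (4 ℕ.* k ℕ.+ 9) (book (1 ℕ.+ k)) (book (3 ℕ.+ k))
  -- Here n = k + 3, so N = 4n - 3 = 4k + 9 and ν = n - 2 = 1 + k. Decidability of containment
  -- justifies arguing by contradiction.
  arrows k k≢3 χ = decidable-stable (containsBook? χ (1 ℕ.+ k) (3 ℕ.+ k)) λ ¬contains →
    k≢3 (4k+13∣400⇒k≡3 k (Extremal.N+4∣400 χ (1ℤ + + k) N≡ (few ¬contains)))
    where
    N≡ : + (4 ℕ.* k ℕ.+ 9) ≡ + 4 * (1ℤ + + k) + + 5
    N≡ = trans (cong (λ z → z + + 9) (pos-* 4 k)) (shift (+ k))
      where
      shift : ∀ k → + 4 * k + + 9 ≡ + 4 * (1ℤ + k) + + 5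
      shift = solve-∀
    few : ¬ ContainsBook χ (1 ℕ.+ k) (3 ℕ.+ k) → ∀ u v → u ≢ v →
      + pages χ (color χ u v) u v ≤ 1ℤ + + k - sign (color χ u v)
    few ¬contains u v u≢v = bound (color χ u v) refl
      where
      bound : ∀ c → color χ u v ≡ c → + pages χ c u v ≤ 1ℤ + + k - sign c
      -- Avoiding the red book on 1 + k pages leaves at most k = ν - 1 pages on a red edge; avoiding
      -- the blue one on 3 + k leaves at most k + 2 = ν + 1 on a blue edge.
      bound red  eq = +≤+ (ℕ.s≤s⁻¹
           (ℕ.≰⇒> λ m≤ → ¬contains (inj₁ (spine⇒book χ (u , v , (u≢v , eq) , m≤)))))
      bound blue eq = subst (λ z → + pages χ blue u v ≤ z) (cong +_ (ℕ.+-comm 1 (suc k)))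
        (+≤+ (ℕ.s≤s⁻¹ (ℕ.≰⇒> λ m≤ → ¬contains (inj₂ (spine⇒book χ (u , v , (u≢v , eq) , m≤))))))

-- Existence and upper bound of the Ramsey number

open import Data.Nat using (_+_; _*_; _∸_; _≤_)

theorem1p2 : (n : ℕ) → 3 ≤ n → n ≢ 6 →
    ∃[ r ] (IsRamseyNumber (book (n ∸ 2)) (book n) r × r ≤ 4 * n ∸ 3)
theorem1p2 (suc (suc (suc k))) (s≤s (s≤s (s≤s z≤n))) n≢6 =
  -- The Ramsey number itself must be exhibited: since the arrow relation is decidable and holds at
  -- 4n - 3, the search for its least instance ends at or below that value.
  least (arrows? (1 + k) (3 + k)) (4 * (3 + k) ∸ 3)
    (subst (λ N → Arrows N (book (1 + k)) (book (3 + k))) N≡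
         (SeidelMatrix.arrows k λ k≡3 → n≢6 (cong (3 +_) k≡3)))
  where
  N≡ : 4 * k + 9 ≡ 4 * (3 + k) ∸ 3
  N≡ = sym (trans (cong (ℕ._∸ 3) (trans (ℕ.*-distribˡ-+ 4 3 k) (ℕ.+-comm 12 (4 * k))))
       (ℕ.+-∸-assoc (4 * k) {12} {3} (s≤s (s≤s (s≤s z≤n)))))
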